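{- For every integer $k\ge 0$, $|I_k(123,132,231)|=1$.
   Context: A permutation of length $n$ is a word $\pi=\pi_1\cdots\pi_n$ containing each of $1,\dots,n$ exactly once. The sum of permutations $\rho=\rho_1\cdots\rho_n$ and $\tau=\tau_1\cdots\tau_m$ is the permutation $\rho\oplus\tau=\rho_1\cdots\rho_n(n+\tau_1)\cdots(n+\tau_m)$ of length $n+m$. A permutation is decomposable if it equals $\rho\oplus\tau$ for some non-empty permutations $\rho,\tau$; a non-empty permutation that is not decomposable is indecomposable. An inversion of $\pi$ is a pair $(i,j)$ with $i<j$ and $\pi_i>\pi_j$. A permutation $\pi$ contains a permutation (pattern) $\tau=\tau_1\cdots\tau_m$ if there are indices $i_1<\dots<i_m$ such that $\pi_{i_1},\dots,\pi_{i_m}$ is order-isomorphic to $\tau_1,\dots,\tau_m$; otherwise $\pi$ avoids $\tau$. $I_k(\tau_1,\dots,\tau_r)$ denotes the (finite) set of all indecomposable permutations, of any length, with exactly $k$ inversions that avoid all of $\tau_1,\dots,\tau_r$. -}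

module Defs where

open import Data.Fin as Fin using (Fin)
open import Data.List using (List; []; _∷_; _++_; map; length; lookup; filter; applyUpTo; allFin; cartesianProduct)
open import Data.List.Membership.Propositional using (_∈_)
open import Data.List.Relation.Binary.Permutation.Propositional using (_↭_)
open import Data.List.Relation.Unary.All using (All)
open import Data.List.Relation.Unary.Unique.Propositional using (Unique)
open import Data.Nat using (ℕ; suc; _+_; _<_; _<?_)
open import Data.Product using (∃-syntax; Σ-syntax; _×_; _,_)
open import Function.Bundles using (_⇔_)
open import Relation.Binary.PropositionalEquality using (_≡_; _≢_)
open import Relation.Nullary using (¬_)
open import Relation.Nullary.Decidable using (_×-dec_)
open import Relation.Unary using (Pred; Decidable)
open import Level using (0ℓ)

Word : Set
Word = List ℕ

IsPermutation : Pred Word 0ℓ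
IsPermutation π = π ↭ applyUpTo suc (length π)

infixr 6 _⊕_

_⊕_ : Word → Word → Word
ρ ⊕ τ = ρ ++ map (length ρ +_) τ

Decomposable : Pred Word 0ℓ
Decomposable π = ∃[ ρ ] ∃[ τ ]
  IsPermutation ρ × IsPermutation τ × ρ ≢ [] × τ ≢ [] × π ≡ ρ ⊕ τ

Indecomposable : Pred Word 0ℓ
Indecomposable π = IsPermutation π × π ≢ [] × ¬ Decomposable π

Position : Word → Set
Position π = Fin (length π)

IsInversion : (π : Word) → Pred (Position π × Position π) 0ℓ
IsInversion π (i , j) = i Fin.< j × lookup π j < lookup π i

isInversion? : (π : Word) → Decidable (IsInversion π)
isInversion? π (i , j) = i Fin.<? j ×-dec lookup π j <? lookup π i

inversions : Word → ℕ
inversions π =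
  length (filter (isInversion? π) (cartesianProduct (allFin (length π)) (allFin (length π))))

Contains : Word → Word → Set
Contains π τ = Σ[ ι ∈ (Position τ → Position π) ]
  (∀ {a b : Position τ} → a Fin.< b → ι a Fin.< ι b) ×
  (∀ (a b : Position τ) → lookup τ a < lookup τ b ⇔ lookup π (ι a) < lookup π (ι b))

Avoids : Word → Word → Set
Avoids π τ = ¬ Contains π τ

I : ℕ → List Word → Pred Word 0ℓ
I k τs π = Indecomposable π × inversions π ≡ k × All (Avoids π) τs

infix 4 ∣_∣≡_

-- A predicate holds of exactly n elements when some duplicate-free list of
-- length n enumerates them.
∣_∣≡_ : {A : Set} → Pred A 0ℓ → ℕ → Set
∣_∣≡_ {A} P n = ∃[ xs ] Unique xs × (∀ (x : A) → x ∈ xs ⇔ P x) × length xs ≡ n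

{-# OPTIONS --safe #-}
module Submission where

-- Why there is exactly one such permutation.  The patterns 123, 132 and 231 are
-- the three ways to place a third letter after an ascent.  A permutation
-- therefore avoids them all exactly when no ascending pair of letters is
-- followed by a further letter, that is, when its letters other than the last
-- are in decreasing order (avoids⇒decreasing, decreasing⇒avoidsPatterns).  Such
-- a permutation is determined by its length and its last letter: it is
-- avoider c u, of length c + u + 1 with last letter u + 1 (perm-avoider).  For
-- c > 0 it starts with its maximum and is indecomposable; for c = 0 the last
-- letter is the maximum, and it is indecomposable only if it has length 1.
--
-- For c > 0, lowering the last letter by one at fixed length, that is, passing
-- from (c , u + 1) to (c + 1 , u), creates exactly one inversion.  At the end of
-- such a chain stands the decreasing permutation of length c + 1, last letter 1;
-- it has one inversion less than the permutation of length c + 2 that starts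
-- the next chain, last letter c + 1.  So the indecomposable avoiders of
-- length at least 2 form a single sequence along which the number of inversions
-- grows by one (inversions-next), starting with the permutation 21, which has
-- one inversion.  Hence each k > 0 occurs exactly once (index-unique), and k = 0
-- occurs only for the permutation 1.

open import Data.Fin as Fin using (Fin; zero; suc)
open import Data.List using (List; []; _∷_; [_]; _++_; _∷ʳ_; map; length; lookup; filter; tabulate; allFin; applyUpTo; applyDownFrom; cartesianProduct)
open import Data.List.Properties using (length-++; length-applyDownFrom; applyUpTo-∷ʳ; filter-≐; filter-++; filter-all; filter-reject; map-tabulate; map-∘; tabulate-lookup; ∷-injectiveˡ)
open import Data.List.Membership.Propositional.Properties using (∈-applyUpTo⁻; ∈-++⁺ʳ; ∈-lookup)
open import Data.List.Relation.Binary.Equality.Propositional using (≋⇒≡)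
open import Data.List.Relation.Binary.Permutation.Propositional using (_↭_; ↭-refl; ↭-sym; ↭-prep; ↭⇒↭ₛ; module PermutationReasoning)
open import Data.List.Relation.Binary.Permutation.Propositional.Properties using (∈-resp-↭; All-resp-↭; ∷↭∷ʳ; drop-∷)
import Data.List.Relation.Binary.Permutation.Setoid.Properties as ↭ₛ
open import Data.List.Relation.Unary.All as All using (All; []; _∷_)
import Data.List.Relation.Unary.All.Properties as All
open import Data.List.Relation.Unary.AllPairs using (AllPairs; []; _∷_)
import Data.List.Relation.Unary.AllPairs.Properties as AllPairs
open import Data.List.Relation.Unary.Any using (here)
open import Data.List.Relation.Unary.Linked as Linked using (Linked; []; [-]; _∷_)
open import Data.List.Relation.Unary.Linked.Properties using (AllPairs⇒Linked)
open import Data.List.Relation.Unary.Sorted.TotalOrder.Properties using (↗↭↗⇒≋)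
open import Data.List.Relation.Unary.Unique.Propositional using (Unique)
import Data.List.Relation.Unary.Unique.Propositional.Properties as Unique
open import Data.Nat using (ℕ; zero; suc; _+_; _∸_; _≤_; _<_; _>_; _<?_; s≤s; z<s; s<s)
open import Data.Nat.Properties
open import Data.Product using (∃-syntax; _×_; _,_; proj₁; proj₂)
open import Data.Sum using (_⊎_; inj₁; inj₂; swap)
open import Function using (_∘_; id; mk⇔)
open import Function.Bundles using (Equivalence; _⇔_)
open import Level using (0ℓ)
open import Relation.Binary using (Rel; tri<; tri≈; tri>)
open import Relation.Binary.PropositionalEquality using (_≡_; _≢_; refl; sym; trans; cong; cong₂; subst; setoid; module ≡-Reasoning)
open import Relation.Binary.Properties.TotalOrder ≤-totalOrder using (≥-totalOrder)
open import Relation.Nullary using (¬_; contradiction; yes; no)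
open import Relation.Unary using (Pred; Decidable; _≐_)
open import Defs

-- Counting inversions letter by letter

variable
  A B : Set

-- The number of entries of a list, with multiplicity, that satisfy P.
count : {P : Pred A 0ℓ} → Decidable P → List A → ℕ
count P? xs = length (filter P? xs)

count-++ : {P : Pred A 0ℓ} (P? : Decidable P) (xs ys : List A) →
           count P? (xs ++ ys) ≡ count P? xs + count P? ys
count-++ P? xs ys = trans (cong length (filter-++ P? xs ys)) (length-++ (filter P? xs))

count-≐ : {P Q : Pred A 0ℓ} (P? : Decidable P) (Q? : Decidable Q) →
          P ≐ Q → ∀ xs → count P? xs ≡ count Q? xs
count-≐ P? Q? P≐Q xs = cong length (filter-≐ P? Q? P≐Q xs)

count-map : {P : Pred B 0ℓ} (P? : Decidable P) (f : A → B) (xs : List A) →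
            count P? (map f xs) ≡ count (P? ∘ f) xs
count-map P? f [] = refl
count-map P? f (x ∷ xs) with P? (f x)
... | yes _ = cong suc (count-map P? f xs)
... | no  _ = count-map P? f xs

-- The inversions at the first position are the later letters below the first.
inversions-∷ : ∀ x xs → inversions (x ∷ xs) ≡ count (_<? x) xs + inversions xs
inversions-∷ x xs = begin
  count inv? (map (zero ,_) (zero ∷ later) ++ cartesianProduct later (zero ∷ later))
    ≡⟨ cong (λ js → count inv? (map (zero ,_) (zero ∷ js) ++ cartesianProduct js (zero ∷ js)))
            (sym (map-tabulate id suc)) ⟩
  count inv? (map (zero ,_) row ++ cartesianProduct (map suc positions) row)
    ≡⟨ count-++ inv? (map (zero ,_) row) _ ⟩
  count inv? (map (zero ,_) row) + count inv? (cartesianProduct (map suc positions) row)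
    ≡⟨ cong₂ _+_ firstRow (laterRows positions) ⟩
  count (_<? x) xs + inversions xs ∎
  where
  open ≡-Reasoning

  inv? = isInversion? (x ∷ xs)

  positions : List (Fin (length xs))
  positions = allFin (length xs)

  later row : List (Fin (suc (length xs)))
  later = tabulate suc
  row   = zero ∷ map suc positions

  firstRow : count inv? (map (zero ,_) row) ≡ count (_<? x) xs
  firstRow = begin
    count inv? (map (zero ,_) row)
      -- A pair ending at the first position is not an inversion.
      ≡⟨⟩
    count inv? (map (zero ,_) (map suc positions))
      ≡⟨ cong (count inv?) (sym (map-∘ positions)) ⟩
    count inv? (map (λ j → zero , suc j) positions)
      ≡⟨ count-map inv? _ positions ⟩
    count (λ j → inv? (zero , suc j)) positions
      ≡⟨ count-≐ _ (λ j → lookup xs j <? x) (proj₂ , (z<s ,_)) positions ⟩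
    count (λ j → lookup xs j <? x) positions
      ≡⟨ count-map (_<? x) (lookup xs) positions ⟨
    count (_<? x) (map (lookup xs) positions)
      ≡⟨ cong (count (_<? x)) (trans (map-tabulate id (lookup xs)) (tabulate-lookup xs)) ⟩
    count (_<? x) xs ∎

  laterRow : ∀ i → count inv? (map (suc i ,_) row)
                 ≡ count (isInversion? xs) (map (i ,_) positions)
  laterRow i = begin
    count inv? (map (suc i ,_) row)
      ≡⟨⟩
    count inv? (map (suc i ,_) (map suc positions))
      ≡⟨ cong (count inv?) (sym (map-∘ positions)) ⟩
    count inv? (map (λ j → suc i , suc j) positions)
      ≡⟨ count-map inv? _ positions ⟩
    count (λ j → inv? (suc i , suc j)) positions
      ≡⟨ count-≐ _ (λ j → isInversion? xs (i , j))
           ((λ { (s<s i<j , y<x) → i<j , y<x }) , (λ { (i<j , y<x) → s<s i<j , y<x }))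
           positions ⟩
    count (λ j → isInversion? xs (i , j)) positions
      ≡⟨ count-map (isInversion? xs) (i ,_) positions ⟨
    count (isInversion? xs) (map (i ,_) positions) ∎

  laterRows : ∀ is → count inv? (cartesianProduct (map suc is) row)
                   ≡ count (isInversion? xs) (cartesianProduct is positions)
  laterRows []       = refl
  laterRows (i ∷ is) = begin
    count inv? (map (suc i ,_) row ++ cartesianProduct (map suc is) row)
      ≡⟨ count-++ inv? (map (suc i ,_) row) _ ⟩
    count inv? (map (suc i ,_) row) + count inv? (cartesianProduct (map suc is) row)
      ≡⟨ cong₂ _+_ (laterRow i) (laterRows is) ⟩
    count (isInversion? xs) (map (i ,_) positions)
      + count (isInversion? xs) (cartesianProduct is positions)
      ≡⟨ count-++ (isInversion? xs) (map (i ,_) positions) _ ⟨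
    count (isInversion? xs) (cartesianProduct (i ∷ is) positions) ∎

inversions-max-∷ : ∀ {x xs} → All (_< x) xs → inversions (x ∷ xs) ≡ length xs + inversions xs
inversions-max-∷ {x} {xs} xs<x =
  trans (inversions-∷ x xs) (cong (λ ys → length ys + inversions xs) (filter-all (_<? x) xs<x))

-- The three patterns and the decreasing initial segment

AllPairs-lookup : {R : Rel A 0ℓ} {xs : List A} → AllPairs R xs →
                  ∀ {i j} → i Fin.< j → R (lookup xs i) (lookup xs j)
AllPairs-lookup (Rx ∷ _)  {zero}  {suc j} _         = All.lookup Rx (∈-lookup j)
AllPairs-lookup (_ ∷ Rxs) {suc i} {suc j} (s<s i<j) = AllPairs-lookup Rxs i<j

-- The pairs (a , b) and (x , y) are ordered the same way, and strictly.
SameOrder : (a b x y : ℕ) → Set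
SameOrder a b x y = (a < b × x < y) ⊎ (b < a × y < x)

SameOrder⇒⇔ : ∀ {a b x y} → SameOrder a b x y → a < b ⇔ x < y
SameOrder⇒⇔ (inj₁ (a<b , x<y)) = mk⇔ (λ _ → x<y) (λ _ → a<b)
SameOrder⇒⇔ (inj₂ (b<a , y<x)) =
  mk⇔ (λ a<b → contradiction b<a (<-asym a<b)) (λ x<y → contradiction y<x (<-asym x<y))

contains-triple : ∀ {a b c} (π : Word) {i j k : Position π} → i Fin.< j → j Fin.< k →
                  SameOrder a b (lookup π i) (lookup π j) →
                  SameOrder a c (lookup π i) (lookup π k) →
                  SameOrder b c (lookup π j) (lookup π k) →
                  Contains π (a ∷ b ∷ c ∷ [])
contains-triple {a} {b} {c} π {i} {j} {k} i<j j<k ab ac bc = ι , mono , order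
  where
  τ = a ∷ b ∷ c ∷ []

  ι : Position τ → Position π
  ι zero             = i
  ι (suc zero)       = j
  ι (suc (suc zero)) = k

  mono : ∀ {p q : Position τ} → p Fin.< q → ι p Fin.< ι q
  mono {zero}           {suc zero}       _ = i<j
  mono {zero}           {suc (suc zero)} _ = <-trans i<j j<k
  mono {suc zero}       {suc (suc zero)} _ = j<k
  mono {suc zero}       {suc zero}       (s<s ())
  mono {suc (suc zero)} {suc zero}       (s<s ())
  mono {suc (suc zero)} {suc (suc zero)} (s<s (s<s ()))

  diagonal : ∀ {x y} → x < x ⇔ y < y
  diagonal = mk⇔ (λ x<x → contradiction x<x (n≮n _)) (λ y<y → contradiction y<y (n≮n _))

  order : ∀ (p q : Position τ) → lookup τ p < lookup τ q ⇔ lookup π (ι p) < lookup π (ι q)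
  order zero             zero             = diagonal
  order zero             (suc zero)       = SameOrder⇒⇔ ab
  order zero             (suc (suc zero)) = SameOrder⇒⇔ ac
  order (suc zero)       zero             = SameOrder⇒⇔ (swap ab)
  order (suc zero)       (suc zero)       = diagonal
  order (suc zero)       (suc (suc zero)) = SameOrder⇒⇔ bc
  order (suc (suc zero)) zero             = SameOrder⇒⇔ (swap ac)
  order (suc (suc zero)) (suc zero)       = SameOrder⇒⇔ (swap bc)
  order (suc (suc zero)) (suc (suc zero)) = diagonal

-- The patterns 123, 132 and 231.
patterns : List Word
patterns = (1 ∷ 2 ∷ 3 ∷ []) ∷ (1 ∷ 3 ∷ 2 ∷ []) ∷ (2 ∷ 3 ∷ 1 ∷ []) ∷ []

-- Removing the last letter leaves a strictly decreasing word.  In terms of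
-- positions: two letters followed by a third one form a descent.
DecreasingBeforeLast : Word → Set
DecreasingBeforeLast π =
  ∀ (i j k : Position π) → i Fin.< j → j Fin.< k → lookup π j < lookup π i

-- The patterns are the three ways to place a third letter after an ascent.
avoids⇒decreasing : ∀ π → Unique π → All (Avoids π) patterns → DecreasingBeforeLast π
avoids⇒decreasing π π! (no123 ∷ no132 ∷ no231 ∷ []) i j k i<j j<k
  with <-cmp (lookup π i) (lookup π j)
... | tri> _ _ y<x = y<x
... | tri≈ _ x≡y _ = contradiction x≡y (AllPairs-lookup π! i<j)
... | tri< x<y _ _ with <-cmp (lookup π j) (lookup π k)
...   | tri< y<z _ _ = contradiction
        (contains-triple π i<j j<k (inj₁ (n<1+n 1 , x<y)) (inj₁ (s<s z<s , <-trans x<y y<z)) (inj₁ (n<1+n 2 , y<z)))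
        no123
...   | tri≈ _ y≡z _ = contradiction y≡z (AllPairs-lookup π! j<k)
...   | tri> _ _ z<y with <-cmp (lookup π i) (lookup π k)
...     | tri< x<z _ _ = contradiction
          (contains-triple π i<j j<k (inj₁ (s<s z<s , x<y)) (inj₁ (n<1+n 1 , x<z)) (inj₂ (n<1+n 2 , z<y)))
          no132
...     | tri≈ _ x≡z _ = contradiction x≡z (AllPairs-lookup π! (<-trans i<j j<k))
...     | tri> _ _ z<x = contradiction
          (contains-triple π i<j j<k (inj₁ (n<1+n 2 , x<y)) (inj₂ (n<1+n 1 , z<x)) (inj₂ (s<s z<s , z<y)))
          no231

-- The first two letters of an occurrence are followed by its third, so they form
-- a descent and cannot represent an ascent of the pattern.
decreasing⇒avoids : ∀ π {a b c} → DecreasingBeforeLast π → a < b → Avoids π (a ∷ b ∷ c ∷ [])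
decreasing⇒avoids π decr a<b (ι , mono , order) = <-asym
  (decr _ _ _ (mono z<s) (mono {suc zero} {suc (suc zero)} (s<s z<s)))
  (Equivalence.to (order zero (suc zero)) a<b)

decreasing⇒avoidsPatterns : ∀ π → DecreasingBeforeLast π → All (Avoids π) patterns
decreasing⇒avoidsPatterns π decr =
  decreasing⇒avoids π decr (n<1+n 1) ∷ decreasing⇒avoids π decr (s<s z<s) ∷
  decreasing⇒avoids π decr (n<1+n 2) ∷ []

-- The first letter is kept outside the decomposition, so that it can be compared
-- with the next one.
decreasing⇒snoc-∷ : ∀ {x y ys} → DecreasingBeforeLast (x ∷ y ∷ ys) →
                    ∃[ ρ ] ∃[ z ] y ∷ ys ≡ ρ ∷ʳ z × Linked _>_ (x ∷ ρ)
decreasing⇒snoc-∷ {ys = []}         decr = [] , _ , refl , [-]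
decreasing⇒snoc-∷ {y = y} {w ∷ ws} decr
  with ρ , z , eq , ρ↘ ← decreasing⇒snoc-∷ {y} {w} {ws}
         (λ i j k i<j j<k → decr (suc i) (suc j) (suc k) (s<s i<j) (s<s j<k))
  = y ∷ ρ , z , cong (y ∷_) eq , decr zero (suc zero) (suc (suc zero)) z<s (s<s z<s) ∷ ρ↘

decreasing⇒snoc : ∀ {π} → π ≢ [] → DecreasingBeforeLast π →
                  ∃[ ρ ] ∃[ z ] π ≡ ρ ∷ʳ z × Linked _>_ ρ
decreasing⇒snoc {[]}         π≢[] _ = contradiction refl π≢[]
decreasing⇒snoc {x ∷ []}     _    _ = [] , x , refl , []
decreasing⇒snoc {x ∷ y ∷ ys} _    decr
  with ρ , z , eq , ρ↘ ← decreasing⇒snoc-∷ {x} {y} {ys} decr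
  = x ∷ ρ , z , cong (x ∷_) eq , ρ↘

All-lookup-∷ʳ : {P : Pred A 0ℓ} {xs : List A} {x : A} → All P xs →
                ∀ {i j : Fin (length (xs ∷ʳ x))} → i Fin.< j → P (lookup (xs ∷ʳ x) i)
All-lookup-∷ʳ []         {zero}  {zero}  ()
All-lookup-∷ʳ (px ∷ pxs) {zero}  {suc j} _         = px
All-lookup-∷ʳ (px ∷ pxs) {suc i} {suc j} (s<s i<j) = All-lookup-∷ʳ pxs i<j

snoc⇒decreasing : ∀ {ρ} z → AllPairs _>_ ρ → DecreasingBeforeLast (ρ ∷ʳ z)
snoc⇒decreasing z []       zero    zero    _       ()
snoc⇒decreasing z (x> ∷ _) zero    (suc j) (suc k) _         (s<s j<k) = All-lookup-∷ʳ x> j<k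
snoc⇒decreasing z (_ ∷ ρ↘) (suc i) (suc j) (suc k) (s<s i<j) (s<s j<k) =
  snoc⇒decreasing z ρ↘ i j k i<j j<k

decreasing-↭⇒≡ : ∀ {ρ σ} → Linked _>_ ρ → Linked _>_ σ → ρ ↭ σ → ρ ≡ σ
decreasing-↭⇒≡ ρ↘ σ↘ ρ↭σ =
  ≋⇒≡ (↗↭↗⇒≋ ≥-totalOrder (Linked.map <⇒≤ ρ↘) (Linked.map <⇒≤ σ↘) (↭⇒↭ₛ ρ↭σ))

-- Permutations

perm-unique : ∀ {π} → IsPermutation π → Unique π
perm-unique {π} π↭ =
  ↭ₛ.Unique-resp-↭ (setoid ℕ) (↭⇒↭ₛ (↭-sym π↭))
    (Unique.applyUpTo⁺₁ suc (length π) (λ i<j _ → <⇒≢ (s<s i<j)))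

perm-bounded : ∀ {π} → IsPermutation π → All (_≤ length π) π
perm-bounded {π} π↭ = All-resp-↭ (↭-sym π↭) (All.applyUpTo⁺₁ suc (length π) id)

-- In a decomposable permutation the first letter belongs to the first summand,
-- whose letters are at most its length.
head-max⇒¬decomposable : ∀ xs → ¬ Decomposable (suc (length xs) ∷ xs)
head-max⇒¬decomposable xs ([]    , τ     , _  , _ , ρ≢[] , _    , _) = ρ≢[] refl
head-max⇒¬decomposable xs (y ∷ ρ , []    , _  , _ , _    , τ≢[] , _) = τ≢[] refl
head-max⇒¬decomposable xs (y ∷ ρ , t ∷ τ , ρ↭ , _ , _    , _    , eq) =
  <⇒≱ shorter (subst (_≤ suc (length ρ)) (sym (∷-injectiveˡ eq)) (All.head (perm-bounded ρ↭)))
  where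
  open ≤-Reasoning
  ys = y ∷ ρ
  zs = map (length ys +_) (t ∷ τ)

  shorter : length ys < suc (length xs)
  shorter = begin-strict
    length ys             <⟨ m<m+n (length ys) z<s ⟩
    length ys + length zs ≡⟨ length-++ ys ⟨
    length (ys ++ zs)     ≡⟨ cong length eq ⟨
    suc (length xs)       ∎

-- The avoiders

-- The letters 1, …, c + u + 1 other than u + 1, in decreasing order.
descend : ℕ → ℕ → Word
descend zero    u = applyDownFrom suc u
descend (suc c) u = suc (suc (c + u)) ∷ descend c u

-- The avoider of length c + u + 1 with last letter u + 1, so that c letters
-- exceed the last one.
avoider : ℕ → ℕ → Word
avoider c u = descend c u ∷ʳ suc u

length-avoider : ∀ c u → length (avoider c u) ≡ suc (c + u)
length-avoider zero    u = begin
  length (applyDownFrom suc u ∷ʳ suc u) ≡⟨ length-++ (applyDownFrom suc u) ⟩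
  length (applyDownFrom suc u) + 1      ≡⟨ cong (_+ 1) (length-applyDownFrom suc u) ⟩
  u + 1                                 ≡⟨ +-comm u 1 ⟩
  suc u                                 ∎
  where open ≡-Reasoning
length-avoider (suc c) u = cong suc (length-avoider c u)

descend-< : ∀ c u → All (_< suc (suc (c + u))) (descend c u)
descend-< zero    u = All.applyDownFrom⁺₁ suc u (λ i<u → s<s (m<n⇒m<1+n i<u))
descend-< (suc c) u = ≤-refl ∷ All.map m<n⇒m<1+n (descend-< c u)

avoider-< : ∀ c u → All (_< suc (suc (c + u))) (avoider c u)
avoider-< c u = All.∷ʳ⁺ (descend-< c u) (s<s (s≤s (m≤n+m u c)))

descend-decreasing : ∀ c u → AllPairs _>_ (descend c u)
descend-decreasing zero    u = AllPairs.applyDownFrom⁺₁ suc u (λ j<i _ → s<s j<i)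
descend-decreasing (suc c) u = descend-< c u ∷ descend-decreasing c u

applyDownFrom↭applyUpTo : (f : ℕ → A) → ∀ n → applyDownFrom f n ↭ applyUpTo f n
applyDownFrom↭applyUpTo f zero    = ↭-refl
applyDownFrom↭applyUpTo f (suc n) = begin
  f n ∷ applyDownFrom f n ↭⟨ ↭-prep (f n) (applyDownFrom↭applyUpTo f n) ⟩
  f n ∷ applyUpTo f n     ↭⟨ ∷↭∷ʳ (f n) (applyUpTo f n) ⟩
  applyUpTo f n ∷ʳ f n    ≡⟨ applyUpTo-∷ʳ f n ⟩
  applyUpTo f (suc n)     ∎
  where open PermutationReasoning

avoider↭ : ∀ c u → avoider c u ↭ applyUpTo suc (suc (c + u))
avoider↭ zero    u = begin
  applyDownFrom suc u ∷ʳ suc u ↭⟨ ∷↭∷ʳ (suc u) (applyDownFrom suc u) ⟨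
  applyDownFrom suc (suc u)    ↭⟨ applyDownFrom↭applyUpTo suc (suc u) ⟩
  applyUpTo suc (suc u)        ∎
  where open PermutationReasoning
avoider↭ (suc c) u = begin
  suc n ∷ avoider c u      ↭⟨ ↭-prep (suc n) (avoider↭ c u) ⟩
  suc n ∷ applyUpTo suc n ↭⟨ ∷↭∷ʳ (suc n) (applyUpTo suc n) ⟩
  applyUpTo suc n ∷ʳ suc n ≡⟨ applyUpTo-∷ʳ suc n ⟩
  applyUpTo suc (suc n)   ∎
  where
  open PermutationReasoning
  n = suc (c + u)

avoider-isPermutation : ∀ c u → IsPermutation (avoider c u)
avoider-isPermutation c u =
  subst (λ n → avoider c u ↭ applyUpTo suc n) (sym (length-avoider c u)) (avoider↭ c u)

avoider-avoids : ∀ c u → All (Avoids (avoider c u)) patterns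
avoider-avoids c u = decreasing⇒avoidsPatterns (avoider c u) (snoc⇒decreasing (suc u) (descend-decreasing c u))

-- The last letter determines the avoider, since the others are in decreasing order.
perm-avoider : ∀ {π} → IsPermutation π → π ≢ [] → All (Avoids π) patterns →
               ∃[ c ] ∃[ u ] π ≡ avoider c u
perm-avoider π↭ π≢[] avoids
  with ρ , z , refl , ρ↘ ← decreasing⇒snoc π≢[] (avoids⇒decreasing _ (perm-unique π↭) avoids)
  with u , u<n , refl ← ∈-applyUpTo⁻ suc (∈-resp-↭ π↭ (∈-++⁺ʳ ρ (here refl)))
  = c , u , cong (_∷ʳ suc u) (decreasing-↭⇒≡ ρ↘ (AllPairs⇒Linked (descend-decreasing c u)) ρ↭)
  where
  n = length (ρ ∷ʳ suc u)
  c = n ∸ suc u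

  length≡ : suc (c + u) ≡ n
  length≡ = trans (sym (+-suc c u)) (m∸n+n≡m u<n)

  open PermutationReasoning

  ρ↭ : ρ ↭ descend c u
  ρ↭ = drop-∷ (begin
    suc u ∷ ρ                   ↭⟨ ∷↭∷ʳ (suc u) ρ ⟩
    ρ ∷ʳ suc u                  ↭⟨ π↭ ⟩
    applyUpTo suc n             ≡⟨ cong (applyUpTo suc) length≡ ⟨
    applyUpTo suc (suc (c + u)) ↭⟨ avoider↭ c u ⟨
    avoider c u                 ↭⟨ ∷↭∷ʳ (suc u) (descend c u) ⟨
    suc u ∷ descend c u         ∎)

avoider-decomposable : ∀ u → Decomposable (avoider 0 (suc u))
avoider-decomposable u =
  ρ , [ 1 ] , ρ↭ , ↭-refl , (λ ()) , (λ ()) ,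
  cong (ρ ∷ʳ_) (trans (+-comm 1 (suc u)) (cong (_+ 1) (sym (length-applyDownFrom suc (suc u)))))
  where
  ρ = applyDownFrom suc (suc u)

  ρ↭ : IsPermutation ρ
  ρ↭ = subst (λ n → ρ ↭ applyUpTo suc n) (sym (length-applyDownFrom suc (suc u)))
             (applyDownFrom↭applyUpTo suc (suc u))

avoider-¬decomposable : ∀ c u → ¬ Decomposable (avoider (suc c) u)
avoider-¬decomposable c u = subst (λ n → ¬ Decomposable (suc n ∷ avoider c u))
  (length-avoider c u) (head-max⇒¬decomposable (avoider c u))

-- Inversion numbers of the avoiders

inversions-avoider-suc : ∀ c u →
  inversions (avoider (suc c) u) ≡ suc (c + u) + inversions (avoider c u)
inversions-avoider-suc c u = trans (inversions-max-∷ (avoider-< c u))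
  (cong (_+ inversions (avoider c u)) (length-avoider c u))

-- Sums 0 + 1 + … + (n - 1).
triangle : ℕ → ℕ
triangle zero    = 0
triangle (suc n) = n + triangle n

inversions-decreasing-∷ʳ : ∀ n z → n < z → inversions (applyDownFrom suc n ∷ʳ z) ≡ triangle n
inversions-decreasing-∷ʳ zero    z _   = refl
inversions-decreasing-∷ʳ (suc n) z n<z = begin
  inversions (suc n ∷ δ ∷ʳ z)                       ≡⟨ inversions-∷ (suc n) (δ ∷ʳ z) ⟩
  count (_<? suc n) (δ ∷ʳ z) + inversions (δ ∷ʳ z)  ≡⟨ cong₂ _+_ below (inversions-decreasing-∷ʳ n z (<⇒≤ n<z)) ⟩
  n + triangle n                                    ∎
  where
  open ≡-Reasoning
  δ = applyDownFrom suc n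

  below : count (_<? suc n) (δ ∷ʳ z) ≡ n
  below = begin
    count (_<? suc n) (δ ∷ʳ z)                    ≡⟨ count-++ (_<? suc n) δ [ z ] ⟩
    count (_<? suc n) δ + count (_<? suc n) [ z ] ≡⟨ cong₂ _+_
      (cong length (filter-all (_<? suc n) (All.applyDownFrom⁺₁ suc n s<s)))
      (cong length (filter-reject (_<? suc n) {xs = []} (<-asym n<z))) ⟩
    length δ + 0                                  ≡⟨ +-identityʳ (length δ) ⟩
    length δ                                      ≡⟨ length-applyDownFrom suc n ⟩
    n                                             ∎

inversions-avoider-zero : ∀ u → inversions (avoider 0 u) ≡ triangle u
inversions-avoider-zero u = inversions-decreasing-∷ʳ u (suc u) ≤-refl

-- Lowering the last letter by one, at fixed length, adds one inversion.
inversions-avoider-shift : ∀ c u →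
  inversions (avoider (suc c) u) ≡ suc (inversions (avoider c (suc u)))
inversions-avoider-shift zero u = begin
  inversions (avoider 1 u)             ≡⟨ inversions-avoider-suc 0 u ⟩
  suc u + inversions (avoider 0 u)     ≡⟨ cong (suc u +_) (inversions-avoider-zero u) ⟩
  suc (triangle (suc u))               ≡⟨ cong suc (inversions-avoider-zero (suc u)) ⟨
  suc (inversions (avoider 0 (suc u))) ∎
  where open ≡-Reasoning
inversions-avoider-shift (suc c) u = begin
  inversions (avoider (suc (suc c)) u)                ≡⟨ inversions-avoider-suc (suc c) u ⟩
  suc (suc c + u) + inversions (avoider (suc c) u)    ≡⟨ cong₂ (λ m n → suc m + n) (sym (+-suc c u)) (inversions-avoider-shift c u) ⟩
  suc (c + suc u) + suc (inversions (avoider c (suc u))) ≡⟨ +-suc (suc (c + suc u)) _ ⟩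
  suc (suc (c + suc u) + inversions (avoider c (suc u))) ≡⟨ cong suc (inversions-avoider-suc c (suc u)) ⟨
  suc (inversions (avoider (suc c) (suc u)))          ∎
  where open ≡-Reasoning

inversions-avoider-last-one : ∀ c → inversions (avoider c 0) ≡ triangle (suc c)
inversions-avoider-last-one zero    = refl
inversions-avoider-last-one (suc c) = begin
  inversions (avoider (suc c) 0)         ≡⟨ inversions-avoider-suc c 0 ⟩
  suc (c + 0) + inversions (avoider c 0) ≡⟨ cong₂ (λ m n → suc m + n) (+-identityʳ c) (inversions-avoider-last-one c) ⟩
  triangle (suc (suc c))                 ∎
  where open ≡-Reasoning

-- Enumeration by the number of inversions

-- The indecomposable avoiders of length at least 2, parametrised by pairs.
indexed : ℕ × ℕ → Word
indexed (c , u) = avoider (suc c) u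

-- The pair whose avoider has one inversion more: the last letter is lowered by
-- one, or, if it is already 1, the length grows by one and the last letter
-- becomes the second largest.
next : ℕ × ℕ → ℕ × ℕ
next (c , suc u) = suc c , u
next (c , zero)  = 0 , suc c

-- The pair p for which indexed p has k + 1 inversions, reached by k steps along
-- the antidiagonals.
index : ℕ → ℕ × ℕ
index zero    = 0 , 0
index (suc k) = next (index k)

inversions-next : ∀ p → inversions (indexed (next p)) ≡ suc (inversions (indexed p))
inversions-next (c , suc u) = inversions-avoider-shift (suc c) u
inversions-next (c , zero)  = begin
  inversions (avoider 1 (suc c))             ≡⟨ inversions-avoider-shift 0 (suc c) ⟩
  suc (inversions (avoider 0 (suc (suc c)))) ≡⟨ cong suc (inversions-avoider-zero (suc (suc c))) ⟩
  suc (triangle (suc (suc c)))               ≡⟨ cong suc (inversions-avoider-last-one (suc c)) ⟨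
  suc (inversions (avoider (suc c) 0))       ∎
  where open ≡-Reasoning

inversions-index : ∀ k → inversions (indexed (index k)) ≡ suc k
inversions-index zero    = refl
inversions-index (suc k) = trans (inversions-next (index k)) (cong suc (inversions-index k))

inversions-indexed-positive : ∀ p → inversions (indexed p) ≢ 0
inversions-indexed-positive (c , u) eq with () ← trans (sym (inversions-avoider-suc c u)) eq

origin-or-next : ∀ p → p ≡ (0 , 0) ⊎ ∃[ q ] p ≡ next q
origin-or-next (zero  , zero)  = inj₁ refl
origin-or-next (zero  , suc u) = inj₂ ((u , 0) , refl)
origin-or-next (suc c , u)     = inj₂ ((c , suc u) , refl)

-- Going back along next lowers the number of inversions by one at each step while
-- it stays positive, so it tells how many steps separate p from the origin.
index-unique : ∀ k p → inversions (indexed p) ≡ suc k → p ≡ index k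
index-unique k p eq with origin-or-next p
index-unique zero    p eq | inj₁ p≡         = p≡
index-unique (suc k) p () | inj₁ refl
index-unique zero    p eq | inj₂ (q , refl) =
  contradiction (suc-injective (trans (sym (inversions-next q)) eq)) (inversions-indexed-positive q)
index-unique (suc k) p eq | inj₂ (q , refl) =
  cong next (index-unique k q (suc-injective (trans (sym (inversions-next q)) eq)))

-- The indecomposable avoider with k inversions.
witness : ℕ → Word
witness zero    = [ 1 ]
witness (suc k) = indexed (index k)

witness-I : ∀ k → I k patterns (witness k)
witness-I zero    =
  (↭-refl , (λ ()) , head-max⇒¬decomposable []) , refl , avoider-avoids 0 0
witness-I (suc k) with c , u ← index k | eq ← inversions-index k =
  (avoider-isPermutation (suc c) u , (λ ()) , avoider-¬decomposable c u) , eq , avoider-avoids (suc c) u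

I-unique : ∀ k π → I k patterns π → π ≡ witness k
I-unique k π ((π↭ , π≢[] , _) , _ , avoids) with perm-avoider π↭ π≢[] avoids
I-unique zero    π (_ , _     , _)           | zero  , zero  , refl = refl
I-unique (suc k) π (_ , ()    , _)           | zero  , zero  , refl
I-unique k       π ((_ , _ , indec) , _ , _) | zero  , suc u , refl = contradiction (avoider-decomposable u) indec
I-unique zero    π (_ , inv≡k , _)           | suc c , u     , refl = contradiction inv≡k (inversions-indexed-positive (c , u))
I-unique (suc k) π (_ , inv≡k , _)           | suc c , u     , refl = cong indexed (index-unique k (c , u) inv≡k)

theorem20 : (k : ℕ) → ∣ I k ((1 ∷ 2 ∷ 3 ∷ []) ∷ (1 ∷ 3 ∷ 2 ∷ []) ∷ (2 ∷ 3 ∷ 1 ∷ []) ∷ []) ∣≡ 1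
theorem20 k =
  [ witness k ] , [] ∷ [] ,
  (λ π → mk⇔ (λ { (here refl) → witness-I k }) (λ π∈I → here (I-unique k π π∈I))) ,
  refl
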